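{- For every integer $k \geq 2$, $\mathsf{TT}^1_k\text{ - }\mathsf{Ext} \equiv_{\mathrm{W}} \mathsf{WF}$.
   Context: A problem $\mathsf{P}$ is a partial multivalued function from $\omega^\omega$ to $\omega^\omega$; elements of its domain are its instances, and for each instance $x$ the set $\mathsf{P}(x)$ of its solutions is nonempty. All objects (numbers, finite strings, subsets of $\omega$ or of $\omega^{<\omega}$, colorings) are coded as elements of $\omega^\omega$ via standard codings. $\mathsf{P} \leq_{\mathrm{W}} \mathsf{Q}$ (Weihrauch reducibility) means there are Turing functionals $\Phi,\Psi$ such that for every instance $x$ of $\mathsf{P}$, $\Phi(x)$ is an instance of $\mathsf{Q}$, and for every $\mathsf{Q}$-solution $y$ of $\Phi(x)$, $\Psi(x \oplus y)$ is a $\mathsf{P}$-solution of $x$; $\mathsf{P}\equiv_{\mathrm{W}}\mathsf{Q}$ means both $\mathsf{P}\leq_{\mathrm{W}}\mathsf{Q}$ and $\mathsf{Q}\leq_{\mathrm{W}}\mathsf{P}$. For $S \subseteq 2^{<\omega}$ and $n\in\omega\cup\{\omega\}$, $S \cong 2^{<n}$ means $(S,\preceq)$ is isomorphic as a partial order to $(2^{<n},\preceq)$, where $\preceq$ is the prefix relation and $2^{<n}$ is the set of binary strings of length $<n$. A set $H$ is monochromatic for a coloring $f$ if $f$ is constant on $H$. $\mathsf{WF}$ is the problem whose instances are all trees $T \subseteq \omega^{<\omega}$ (sets closed under prefixes), the unique solution being $0$ if $T$ has an infinite path and $1$ if $T$ is well-founded. $\mathsf{TT}^1_k\text{ - }\mathsf{Ext}$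 is the problem whose instances are pairs $\langle f,\sigma\rangle$ with $f:2^{<\omega}\to k=\{0,\dots,k-1\}$ and $\sigma\in 2^{<\omega}$, the unique solution being $1$ if there exists $H \cong 2^{<\omega}$ monochromatic for $f$ with $\sigma \in H$, and $0$ otherwise. -}

module Defs where

open import Level using (Level; 0ℓ; Lift) renaming (suc to lsuc)
open import Data.Nat using (ℕ; zero; suc; _+_; _*_; _<_)
open import Data.Bool using (Bool; true; false)
open import Data.Fin using (Fin)
open import Data.List using (List; []; _∷_; _++_)
open import Data.Vec using (Vec; []; _∷_; lookup)
open import Data.Product using (Σ; ∃; _×_; _,_)
open import Data.Sum using (_⊎_)
open import Relation.Nullary using (¬_)
open import Relation.Binary.PropositionalEquality using (_≡_)

Seq : Set
Seq = ℕ → ℕ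

-- x ⊕ y : (x ⊕ y)(2n) = x n , (x ⊕ y)(2n+1) = y n
_⊕_ : Seq → Seq → Seq
(x ⊕ y) zero = x zero
(x ⊕ y) (suc zero) = y zero
(x ⊕ y) (suc (suc n)) = ((λ m → x (suc m)) ⊕ (λ m → y (suc m))) n

-- A Turing functional is a term Φ of arity 1; Φ(x) is
-- defined iff n ↦ Φ^x(n) is total, and then Φ(x) is that sequence.

data PR : ℕ → Set where
  zer  : ∀ {n} → PR n
  succ : PR 1
  proj : ∀ {n} → Fin n → PR n
  orc  : PR 1
  comp : ∀ {n m} → PR m → Vec (PR n) m → PR n
  prim : ∀ {n} → PR n → PR (suc (suc n)) → PR (suc n)
  mu   : ∀ {n} → PR (suc n) → PR n

mutual
  data Eval (x : Seq) : ∀ {n} → PR n → Vec ℕ n → ℕ → Set where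
    e-zer  : ∀ {n} {as : Vec ℕ n} → Eval x zer as 0
    e-succ : ∀ {a} → Eval x succ (a ∷ []) (suc a)
    e-proj : ∀ {n} {i : Fin n} {as} → Eval x (proj i) as (lookup as i)
    e-orc  : ∀ {a} → Eval x orc (a ∷ []) (x a)
    e-comp : ∀ {n m} {f : PR m} {gs : Vec (PR n) m} {as ys v} →
             EvalVec x gs as ys → Eval x f ys v → Eval x (comp f gs) as v
    e-prim0 : ∀ {n} {g : PR n} {h} {as v} →
              Eval x g as v → Eval x (prim g h) (0 ∷ as) v
    e-primS : ∀ {n} {g : PR n} {h} {as a r v} →
              Eval x (prim g h) (a ∷ as) r →
              Eval x h (a ∷ r ∷ as) v →
              Eval x (prim g h) (suc a ∷ as) v
    e-mu   : ∀ {n} {f : PR (suc n)} {as m} →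
             MuSearch x f as 0 m → Eval x (mu f) as m

  data EvalVec (x : Seq) {n : ℕ} : ∀ {m} → Vec (PR n) m → Vec ℕ n → Vec ℕ m → Set where
    ev-[] : ∀ {as} → EvalVec x [] as []
    ev-∷  : ∀ {m} {g} {gs : Vec (PR n) m} {as y ys} →
            Eval x g as y → EvalVec x gs as ys → EvalVec x (g ∷ gs) as (y ∷ ys)

  data MuSearch (x : Seq) {n : ℕ} (f : PR (suc n)) (as : Vec ℕ n) : ℕ → ℕ → Set where
    mu-found : ∀ {i} → Eval x f (i ∷ as) 0 → MuSearch x f as i i
    mu-step  : ∀ {i m v} → Eval x f (i ∷ as) (suc v) →
               MuSearch x f as (suc i) m → MuSearch x f as i m

TuringFunctional : Set
TuringFunctional = PR 1

_⟨_⟩≡_ : TuringFunctional → Seq → Seq → Set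
Φ ⟨ x ⟩≡ y = ∀ n → Eval x Φ (n ∷ []) (y n)

record Problem : Set₂ where
  field
    Inst : Seq → Set₁
    Sol  : Seq → Seq → Set₁
open Problem public

_≤W_ : Problem → Problem → Set₁
P ≤W Q = Σ TuringFunctional λ Φ → Σ TuringFunctional λ Ψ →
  ∀ x → Inst P x →
    Σ Seq λ x' → Φ ⟨ x ⟩≡ x' × Inst Q x' ×
      (∀ y → Sol Q x' y → Σ Seq λ z → Ψ ⟨ x ⊕ y ⟩≡ z × Sol P x z)

_≡W_ : Problem → Problem → Set₁
P ≡W Q = (P ≤W Q) × (Q ≤W P)

tri : ℕ → ℕ
tri zero = zero
tri (suc n) = suc n + tri n

pair : ℕ → ℕ → ℕ
pair a b = tri (a + b) + b

code : List ℕ → ℕ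
code [] = 0
code (a ∷ s) = suc (pair a (code s))

bit : Bool → ℕ
bit false = 0
bit true = 1

codeB : List Bool → ℕ
codeB [] = 0
codeB (b ∷ σ) = suc (bit b + 2 * codeB σ)

-- a number n as an element of ω^ω: the constant sequence n
IsNum : ℕ → Seq → Set
IsNum n y = ∀ m → y m ≡ n

_∈T_ : List ℕ → Seq → Set
s ∈T x = x (code s) ≡ 1

IsTree : Seq → Set
IsTree x = (∀ n → x n ≡ 0 ⊎ x n ≡ 1) × (∀ s t → (s ++ t) ∈T x → s ∈T x)

initSeg : Seq → ℕ → List ℕ
initSeg p zero = []
initSeg p (suc n) = p zero ∷ initSeg (λ m → p (suc m)) n

HasPath : Seq → Set
HasPath x = Σ Seq λ p → ∀ n → initSeg p n ∈T x

WF : Problem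
Inst WF x = Lift (lsuc 0ℓ) (IsTree x)
Sol WF x y = Lift (lsuc 0ℓ) ((HasPath x × IsNum 0 y) ⊎ (¬ HasPath x × IsNum 1 y))

-- TT¹_k-Ext
-- An instance ⟨f, σ⟩ is coded by x with x 0 = codeB σ and
-- x (suc (codeB τ)) = f τ.

_⪯_ : List Bool → List Bool → Set
τ ⪯ ρ = Σ (List Bool) λ υ → τ ++ υ ≡ ρ

IsoFullTree : (List Bool → Set) → Set
IsoFullTree H = Σ (List Bool → List Bool) λ g →
  (∀ τ → H (g τ)) ×
  (∀ ρ → H ρ → Σ (List Bool) λ τ → g τ ≡ ρ) ×
  (∀ τ τ' → g τ ≡ g τ' → τ ≡ τ') ×
  (∀ τ τ' → (τ ⪯ τ' → g τ ⪯ g τ') × (g τ ⪯ g τ' → τ ⪯ τ'))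

colour : Seq → List Bool → ℕ
colour x τ = x (suc (codeB τ))

Monochromatic : Seq → (List Bool → Set) → Set
Monochromatic x H = Σ ℕ λ c → ∀ ρ → H ρ → colour x ρ ≡ c

ExtTo : Seq → Set₁
ExtTo x = Σ (List Bool) λ σ → codeB σ ≡ x 0 ×
  Σ (List Bool → Set) λ H → IsoFullTree H × Monochromatic x H × H σ

TTExt : ℕ → Problem
Inst (TTExt k) x = Lift (lsuc 0ℓ) (∀ τ → colour x τ < k)
Sol (TTExt k) x y = (ExtTo x × Lift (lsuc 0ℓ) (IsNum 1 y)) ⊎ (¬ ExtTo x × Lift (lsuc 0ℓ) (IsNum 0 y))

{-# OPTIONS --safe #-}
module Submission where

-- Both reductions compute an instance of the other problem by primitive
-- recursion relative to the given instance, and flip the 0/1 answer.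
--
-- TT¹_k-Ext ≤ WF: a sequence e is read as the map g τ = decodeB (e (codeB τ)).
-- A finite sequence is a node of the tree when every pair of its positions
-- passes a decidable test saying that g sends the root to σ, has constant
-- colour, and preserves and reflects the prefix order. So the paths are the
-- monochromatic copies of 2^{<ω} with root σ; and a copy containing σ,
-- restricted to the part above the preimage of σ, is such a path.
--
-- WF ≤ TT¹_k-Ext: a binary string gets colour 0 iff it is a concatenation of
-- blocks, each coding an entry and a free bit, whose entries form a node of
-- the tree. A path p gives the colour-0 copy τ ↦ blocks of (p i , τ i).
-- Conversely, in a colour-0 copy containing the root, the images of the
-- strings 0ⁿ parse into a strictly increasing chain of nodes, whose limit
-- is a path. Only colours 0 and 1 occur, so any k ≥ 2 works.

open import Defs
open import Level using (lift; lower)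
open import Function using (_∘_; id)
open import Data.Nat using (ℕ; zero; suc; _+_; _*_; _∸_; _≤_; _<_; z≤n; s≤s; s≤s⁻¹; _≤?_; _<?_)
open import Data.Nat.Properties
open import Data.Fin using (Fin) renaming (zero to fz; suc to fs)
open import Data.Vec using (Vec; []; _∷_; lookup; tabulate)
open import Data.Vec.Properties using (tabulate∘lookup)
open import Data.Bool using (Bool; true; false)
open import Data.List using (List; []; _∷_; _++_; length; drop; replicate; map)
open import Data.List.Properties
  using (++-identityʳ; ++-assoc; ++-identityʳ-unique; ++-cancelˡ; ++-conicalˡ; ∷-injectiveˡ; ∷-injectiveʳ;
         map-++; length-++; drop-all; drop-drop)
open import Data.Sum using (_⊎_; inj₁; inj₂; [_,_]′)
open import Data.Product using (Σ; _×_; _,_; proj₁; proj₂)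
open import Data.Unit using (⊤; tt)
open import Data.Empty using (⊥; ⊥-elim)
open import Relation.Nullary using (yes; no)
open import Relation.Binary.PropositionalEquality

cong₃ : ∀ {A B C D : Set} (f : A → B → C → D) {a a′ b b′ c c′} →
        a ≡ a′ → b ≡ b′ → c ≡ c′ → f a b c ≡ f a′ b′ c′
cong₃ f refl refl refl = refl

primRec : ℕ → (ℕ → ℕ → ℕ) → ℕ → ℕ
primRec b s zero = b
primRec b s (suc k) = s k (primRec b s k)

-- Terms are total by construction, so a term of arity 1 gives a Turing
-- functional whose value is described by the Agda function ⟦ t ⟧.
data Term : ℕ → Set where
  var  : ∀ {n} → Fin n → Term n
  `0   : ∀ {n} → Term n
  `suc : ∀ {n} → Term n → Term n
  `orc : ∀ {n} → Term n → Term n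
  `app : ∀ {n m} → Term m → Vec (Term n) m → Term n
  `rec : ∀ {n} → Term n → Term (suc (suc n)) → Term n → Term n

mutual
  ⟦_⟧ : ∀ {n} → Term n → Seq → Vec ℕ n → ℕ
  ⟦ var i ⟧ x as = lookup as i
  ⟦ `0 ⟧ x as = 0
  ⟦ `suc t ⟧ x as = suc (⟦ t ⟧ x as)
  ⟦ `orc t ⟧ x as = x (⟦ t ⟧ x as)
  ⟦ `app f ts ⟧ x as = ⟦ f ⟧ x (⟦ ts ⟧* x as)
  ⟦ `rec b s k ⟧ x as = primRec (⟦ b ⟧ x as) (λ i r → ⟦ s ⟧ x (i ∷ r ∷ as)) (⟦ k ⟧ x as)

  ⟦_⟧* : ∀ {n m} → Vec (Term n) m → Seq → Vec ℕ n → Vec ℕ m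
  ⟦ [] ⟧* x as = []
  ⟦ t ∷ ts ⟧* x as = ⟦ t ⟧ x as ∷ ⟦ ts ⟧* x as

projections : ∀ {n} → Vec (PR n) n
projections = tabulate proj

mutual
  compile : ∀ {n} → Term n → PR n
  compile (var i) = proj i
  compile `0 = zer
  compile (`suc t) = comp succ (compile t ∷ [])
  compile (`orc t) = comp orc (compile t ∷ [])
  compile (`app f ts) = comp (compile f) (compile* ts)
  compile (`rec b s k) = comp (prim (compile b) (compile s)) (compile k ∷ projections)

  compile* : ∀ {n m} → Vec (Term n) m → Vec (PR n) m
  compile* [] = []
  compile* (t ∷ ts) = compile t ∷ compile* ts

eval-projections : ∀ x {n} (as : Vec ℕ n) → EvalVec x projections as as
eval-projections x as = subst (EvalVec x projections as) (tabulate∘lookup as) (go (λ i → i))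
  where
  go : ∀ {m} (f : Fin m → Fin _) → EvalVec x (tabulate (λ i → proj (f i))) as (tabulate (λ i → lookup as (f i)))
  go {zero} f = ev-[]
  go {suc m} f = ev-∷ e-proj (go (λ i → f (fs i)))

mutual
  compile-correct : ∀ x {n} (t : Term n) as → Eval x (compile t) as (⟦ t ⟧ x as)
  compile-correct x (var i) as = e-proj
  compile-correct x `0 as = e-zer
  compile-correct x (`suc t) as = e-comp (ev-∷ (compile-correct x t as) ev-[]) e-succ
  compile-correct x (`orc t) as = e-comp (ev-∷ (compile-correct x t as) ev-[]) e-orc
  compile-correct x (`app f ts) as = e-comp (compile*-correct x ts as) (compile-correct x f _)
  compile-correct x (`rec b s k) as =
    e-comp (ev-∷ (compile-correct x k as) (eval-projections x as)) (recursion (⟦ k ⟧ x as))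
    where
    recursion : ∀ K → Eval x (prim (compile b) (compile s)) (K ∷ as)
                           (primRec (⟦ b ⟧ x as) (λ i r → ⟦ s ⟧ x (i ∷ r ∷ as)) K)
    recursion zero = e-prim0 (compile-correct x b as)
    recursion (suc K) = e-primS (recursion K) (compile-correct x s _)

  compile*-correct : ∀ x {n m} (ts : Vec (Term n) m) as → EvalVec x (compile* ts) as (⟦ ts ⟧* x as)
  compile*-correct x [] as = ev-[]
  compile*-correct x (t ∷ ts) as = ev-∷ (compile-correct x t as) (compile*-correct x ts as)

computes : ∀ (t : Term 1) x → compile t ⟨ x ⟩≡ (λ n → ⟦ t ⟧ x (n ∷ []))
computes t x n = compile-correct x t (n ∷ [])

computes-as : ∀ (t : Term 1) x f → (∀ n → ⟦ t ⟧ x (n ∷ []) ≡ f n) → compile t ⟨ x ⟩≡ f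
computes-as t x f sem n = subst (Eval x (compile t) (n ∷ [])) (sem n) (computes t x n)

_+ᵖ_ : ℕ → ℕ → ℕ
a +ᵖ b = primRec a (λ _ r → suc r) b

predᵖ : ℕ → ℕ
predᵖ n = primRec 0 (λ i _ → i) n

_∸ᵖ_ : ℕ → ℕ → ℕ
a ∸ᵖ b = primRec a (λ _ r → predᵖ r) b

ifZero : ℕ → ℕ → ℕ → ℕ
ifZero c a b = primRec a (λ _ _ → b) c

parity : ℕ → ℕ
parity n = primRec 0 (λ _ r → ifZero r 1 0) n

half : ℕ → ℕ
half n = primRec 0 (λ i r → r +ᵖ parity i) n

triᵖ : ℕ → ℕ
triᵖ n = primRec 0 (λ i r → suc (i +ᵖ r)) n

pairᵖ : ℕ → ℕ → ℕ
pairᵖ a b = triᵖ (a +ᵖ b) +ᵖ b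

-- the largest w ≤ n with tri w ≤ n
diagonal : ℕ → ℕ
diagonal n = primRec 0 (λ i r → ifZero (triᵖ (suc i) ∸ᵖ n) (suc i) r) n

unpair₂ : ℕ → ℕ
unpair₂ n = n ∸ᵖ triᵖ (diagonal n)

unpair₁ : ℕ → ℕ
unpair₁ n = diagonal n ∸ᵖ unpair₂ n

#0 : ∀ {n} → Term (suc n)
#0 = var fz
#1 : ∀ {n} → Term (suc (suc n))
#1 = var (fs fz)
#2 : ∀ {n} → Term (suc (suc (suc n)))
#2 = var (fs (fs fz))
#3 : ∀ {n} → Term (suc (suc (suc (suc n))))
#3 = var (fs (fs (fs fz)))
#4 : ∀ {n} → Term (suc (suc (suc (suc (suc n)))))
#4 = var (fs (fs (fs (fs fz))))

`1 `2 `3 : ∀ {n} → Term n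
`1 = `suc `0
`2 = `suc `1
`3 = `suc `2

-- The semantics of each closed program fooT, and of its use fooᵀ at any
-- arity, is by computation the function foo (or fooᵖ) defined above it.

addT : Term 2
addT = `rec #0 (`suc #1) #1

_+ᵀ_ : ∀ {n} → Term n → Term n → Term n
a +ᵀ b = `app addT (a ∷ b ∷ [])

predT : Term 1
predT = `rec `0 #0 #0

monusT : Term 2
monusT = `rec #0 (`app predT (#1 ∷ [])) #1

_∸ᵀ_ : ∀ {n} → Term n → Term n → Term n
a ∸ᵀ b = `app monusT (a ∷ b ∷ [])

ifZeroT : Term 3
ifZeroT = `rec #1 #4 #0

ifZeroᵀ : ∀ {n} → Term n → Term n → Term n → Term n
ifZeroᵀ c a b = `app ifZeroT (c ∷ a ∷ b ∷ [])

parityT : Term 1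
parityT = `rec `0 (ifZeroᵀ #1 `1 `0) #0

parityᵀ : ∀ {n} → Term n → Term n
parityᵀ a = `app parityT (a ∷ [])

halfT : Term 1
halfT = `rec `0 (#1 +ᵀ parityᵀ #0) #0

halfᵀ : ∀ {n} → Term n → Term n
halfᵀ a = `app halfT (a ∷ [])

triT : Term 1
triT = `rec `0 (`suc (#0 +ᵀ #1)) #0

triᵀ : ∀ {n} → Term n → Term n
triᵀ a = `app triT (a ∷ [])

pairᵀ : ∀ {n} → Term n → Term n → Term n
pairᵀ a b = triᵀ (a +ᵀ b) +ᵀ b

diagonalT : Term 1
diagonalT = `rec `0 (ifZeroᵀ (triᵀ (`suc #0) ∸ᵀ #2) (`suc #0) #1) #0

unpair₂T : Term 1
unpair₂T = #0 ∸ᵀ triᵀ (`app diagonalT (#0 ∷ []))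

unpair₂ᵀ : ∀ {n} → Term n → Term n
unpair₂ᵀ a = `app unpair₂T (a ∷ [])

unpair₁ᵀ : ∀ {n} → Term n → Term n
unpair₁ᵀ a = `app (`app diagonalT (#0 ∷ []) ∸ᵀ unpair₂ᵀ #0) (a ∷ [])

+ᵖ≡+ : ∀ a b → a +ᵖ b ≡ a + b
+ᵖ≡+ a zero = sym (+-identityʳ a)
+ᵖ≡+ a (suc b) = trans (cong suc (+ᵖ≡+ a b)) (sym (+-suc a b))

predᵖ≡pred : ∀ n → predᵖ n ≡ n ∸ 1
predᵖ≡pred zero = refl
predᵖ≡pred (suc n) = refl

∸ᵖ≡∸ : ∀ a b → a ∸ᵖ b ≡ a ∸ b
∸ᵖ≡∸ a zero = refl
∸ᵖ≡∸ a (suc b) = begin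
  predᵖ (a ∸ᵖ b)  ≡⟨ predᵖ≡pred (a ∸ᵖ b) ⟩
  a ∸ᵖ b ∸ 1      ≡⟨ cong (_∸ 1) (∸ᵖ≡∸ a b) ⟩
  a ∸ b ∸ 1       ≡⟨ ∸-+-assoc a b 1 ⟩
  a ∸ (b + 1)     ≡⟨ cong (a ∸_) (+-comm b 1) ⟩
  a ∸ suc b       ∎
  where open ≡-Reasoning

ifZero-≢0 : ∀ c a b → c ≢ 0 → ifZero c a b ≡ b
ifZero-≢0 zero a b c≢0 = ⊥-elim (c≢0 refl)
ifZero-≢0 (suc c) a b _ = refl

parity∈01 : ∀ n → parity n ≡ 0 ⊎ parity n ≡ 1
parity∈01 zero = inj₁ refl
parity∈01 (suc n) with parity n | parity∈01 n
... | .0 | inj₁ refl = inj₂ refl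
... | .1 | inj₂ refl = inj₁ refl

parity-suc-suc : ∀ n → parity (suc (suc n)) ≡ parity n
parity-suc-suc n with parity n | parity∈01 n
... | .0 | inj₁ refl = refl
... | .1 | inj₂ refl = refl

half-suc-suc : ∀ n → half (suc (suc n)) ≡ suc (half n)
half-suc-suc n = go (half n) (parity n) (parity∈01 n)
  where
  go : ∀ h p → p ≡ 0 ⊎ p ≡ 1 → (h +ᵖ p) +ᵖ ifZero p 1 0 ≡ suc h
  go h .0 (inj₁ refl) = refl
  go h .1 (inj₂ refl) = refl

+2*-suc : ∀ r c → r + 2 * suc c ≡ suc (suc (r + 2 * c))
+2*-suc r c = trans (cong (r +_) (*-suc 2 c)) (trans (+-suc r (suc (2 * c))) (cong suc (+-suc r (2 * c))))

parity-+2* : ∀ r c → parity (r + 2 * c) ≡ parity r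
parity-+2* r zero = cong parity (+-identityʳ r)
parity-+2* r (suc c) = trans (cong parity (+2*-suc r c)) (trans (parity-suc-suc (r + 2 * c)) (parity-+2* r c))

half-+2* : ∀ r c → half (r + 2 * c) ≡ half r + c
half-+2* r zero = trans (cong half (+-identityʳ r)) (sym (+-identityʳ (half r)))
half-+2* r (suc c) = begin
  half (r + 2 * suc c)          ≡⟨ cong half (+2*-suc r c) ⟩
  half (suc (suc (r + 2 * c)))  ≡⟨ half-suc-suc (r + 2 * c) ⟩
  suc (half (r + 2 * c))        ≡⟨ cong suc (half-+2* r c) ⟩
  suc (half r + c)              ≡⟨ sym (+-suc (half r) c) ⟩
  half r + suc c                ∎
  where open ≡-Reasoning

parity-bit : ∀ b c → parity (bit b + 2 * c) ≡ bit b
parity-bit false c = parity-+2* 0 c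
parity-bit true c = parity-+2* 1 c

half-bit : ∀ b c → half (bit b + 2 * c) ≡ c
half-bit false c = half-+2* 0 c
half-bit true c = half-+2* 1 c

parity+2*half : ∀ n → parity n + 2 * half n ≡ n
parity+2*half zero = refl
parity+2*half (suc zero) = refl
parity+2*half (suc (suc n)) = begin
  parity (suc (suc n)) + 2 * half (suc (suc n))  ≡⟨ cong₂ (λ p h → p + 2 * h) (parity-suc-suc n) (half-suc-suc n) ⟩
  parity n + 2 * suc (half n)                     ≡⟨ +2*-suc (parity n) (half n) ⟩
  suc (suc (parity n + 2 * half n))               ≡⟨ cong (suc ∘ suc) (parity+2*half n) ⟩
  suc (suc n)                                     ∎
  where open ≡-Reasoning

triᵖ≡tri : ∀ n → triᵖ n ≡ tri n
triᵖ≡tri zero = refl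
triᵖ≡tri (suc n) = cong suc (trans (+ᵖ≡+ n (triᵖ n)) (cong (n +_) (triᵖ≡tri n)))

pairᵖ≡pair : ∀ a b → pairᵖ a b ≡ pair a b
pairᵖ≡pair a b = trans (+ᵖ≡+ _ b) (cong (_+ b) (trans (cong triᵖ (+ᵖ≡+ a b)) (triᵖ≡tri (a + b))))

tri-mono : ∀ {i j} → i ≤ j → tri i ≤ tri j
tri-mono {zero} _ = z≤n
tri-mono {suc i} {suc j} (s≤s i≤j) = s≤s (+-mono-≤ i≤j (tri-mono i≤j))

n≤tri : ∀ n → n ≤ tri n
n≤tri zero = z≤n
n≤tri (suc n) = s≤s (m≤m+n n (tri n))

module _ (w b : ℕ) (b≤w : b ≤ w) where
  private
    N = tri w + b
    step : ℕ → ℕ → ℕ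
    step i r = ifZero (triᵖ (suc i) ∸ᵖ N) (suc i) r

    triᵖ∸ᵖN≡ : ∀ k → triᵖ k ∸ᵖ N ≡ tri k ∸ N
    triᵖ∸ᵖN≡ k = trans (∸ᵖ≡∸ _ N) (cong (_∸ N) (triᵖ≡tri k))

    search-below : ∀ k → k ≤ w → primRec 0 step k ≡ k
    search-below zero _ = refl
    search-below (suc k) k<w = cong (λ c → ifZero c (suc k) (primRec 0 step k))
      (trans (triᵖ∸ᵖN≡ (suc k)) (m≤n⇒m∸n≡0 (≤-trans (tri-mono k<w) (m≤m+n (tri w) b))))

    N<tri : ∀ {k} → w < k → N < tri k
    N<tri {k} w<k = begin-strict
      tri w + b  ≤⟨ +-monoʳ-≤ (tri w) b≤w ⟩
      tri w + w  <⟨ ≤-reflexive (cong suc (+-comm (tri w) w)) ⟩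
      tri (suc w) ≤⟨ tri-mono w<k ⟩
      tri k      ∎
      where open ≤-Reasoning

    search-above : ∀ k → w ≤ k → primRec 0 step k ≡ w
    search-above k w≤k with m≤n⇒m<n∨m≡n w≤k
    ... | inj₂ refl = search-below w ≤-refl
    search-above (suc k) _ | inj₁ (s≤s w≤k) =
      trans (ifZero-≢0 (triᵖ (suc k) ∸ᵖ N) (suc k) (primRec 0 step k) test≢0) (search-above k w≤k)
      where
      test≢0 : triᵖ (suc k) ∸ᵖ N ≢ 0
      test≢0 e = <⇒≱ (N<tri (s≤s w≤k)) (m∸n≡0⇒m≤n (trans (sym (triᵖ∸ᵖN≡ (suc k))) e))

  diagonal-pair : diagonal N ≡ w
  diagonal-pair = search-above N (≤-trans (n≤tri w) (m≤m+n (tri w) b))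

unpair₂-pair : ∀ a b → unpair₂ (pair a b) ≡ b
unpair₂-pair a b = begin
  pair a b ∸ᵖ triᵖ (diagonal (pair a b))  ≡⟨ ∸ᵖ≡∸ (pair a b) (triᵖ (diagonal (pair a b))) ⟩
  pair a b ∸ triᵖ (diagonal (pair a b))   ≡⟨ cong (λ w → pair a b ∸ triᵖ w) (diagonal-pair (a + b) b (m≤n+m b a)) ⟩
  pair a b ∸ triᵖ (a + b)                 ≡⟨ cong (pair a b ∸_) (triᵖ≡tri (a + b)) ⟩
  pair a b ∸ tri (a + b)                  ≡⟨ m+n∸m≡n (tri (a + b)) b ⟩
  b                                       ∎
  where open ≡-Reasoning

unpair₁-pair : ∀ a b → unpair₁ (pair a b) ≡ a
unpair₁-pair a b = begin
  diagonal (pair a b) ∸ᵖ unpair₂ (pair a b)  ≡⟨ ∸ᵖ≡∸ (diagonal (pair a b)) (unpair₂ (pair a b)) ⟩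
  diagonal (pair a b) ∸ unpair₂ (pair a b)   ≡⟨ cong₂ _∸_ (diagonal-pair (a + b) b (m≤n+m b a)) (unpair₂-pair a b) ⟩
  (a + b) ∸ b                                ≡⟨ m+n∸n≡m a b ⟩
  a                                          ∎
  where open ≡-Reasoning

≡1⇒≢0 : ∀ {n} → n ≡ 1 → n ≢ 0
≡1⇒≢0 refl ()

-- Decidable tests, with 0 for false

_≟ᵖ_ : ℕ → ℕ → ℕ
a ≟ᵖ b = ifZero ((a ∸ᵖ b) +ᵖ (b ∸ᵖ a)) 1 0

_∧ᵖ_ : ℕ → ℕ → ℕ
p ∧ᵖ q = ifZero p 0 q

allBelow : ℕ → (ℕ → ℕ) → ℕ
allBelow k P = primRec 1 (λ i r → ifZero r 0 (ifZero (P i) 0 1)) k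

allᵀ : ∀ {n} → Term n → Term (suc (suc n)) → Term n
allᵀ k P = `rec `1 (ifZeroᵀ #1 `0 (ifZeroᵀ P `0 `1)) k

_≟ᵀ_ : ∀ {n} → Term n → Term n → Term n
a ≟ᵀ b = ifZeroᵀ ((a ∸ᵀ b) +ᵀ (b ∸ᵀ a)) `1 `0

_∧ᵀ_ : ∀ {n} → Term n → Term n → Term n
p ∧ᵀ q = ifZeroᵀ p `0 q

≟ᵖ-refl : ∀ a → a ≟ᵖ a ≡ 1
≟ᵖ-refl a rewrite ∸ᵖ≡∸ a a | n∸n≡0 a = refl

≟ᵖ-sound : ∀ a b → a ≟ᵖ b ≢ 0 → a ≡ b
≟ᵖ-sound a b h with (a ∸ᵖ b) +ᵖ (b ∸ᵖ a) in eq
... | suc _ = ⊥-elim (h refl)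
... | zero = ≤-antisym (m∸n≡0⇒m≤n (m+n≡0⇒m≡0 (a ∸ b) both≡0))
                      (m∸n≡0⇒m≤n (m+n≡0⇒n≡0 (a ∸ b) both≡0))
  where
  both≡0 : (a ∸ b) + (b ∸ a) ≡ 0
  both≡0 = trans (sym (trans (+ᵖ≡+ (a ∸ᵖ b) (b ∸ᵖ a)) (cong₂ _+_ (∸ᵖ≡∸ a b) (∸ᵖ≡∸ b a)))) eq

≟ᵖ-complete : ∀ {a b} → a ≡ b → a ≟ᵖ b ≢ 0
≟ᵖ-complete {a} refl = ≡1⇒≢0 (≟ᵖ-refl a)

∧ᵖ-sound : ∀ p q → p ∧ᵖ q ≢ 0 → p ≢ 0 × q ≢ 0
∧ᵖ-sound zero q h = ⊥-elim (h refl)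
∧ᵖ-sound (suc p) q h = (λ ()) , h

∧ᵖ-complete : ∀ p q → p ≢ 0 → q ≢ 0 → p ∧ᵖ q ≢ 0
∧ᵖ-complete zero q p≢0 _ = ⊥-elim (p≢0 refl)
∧ᵖ-complete (suc p) q _ q≢0 = q≢0

allBelow∈01 : ∀ k P → allBelow k P ≡ 0 ⊎ allBelow k P ≡ 1
allBelow∈01 zero P = inj₂ refl
allBelow∈01 (suc k) P with allBelow k P
... | zero = inj₁ refl
... | suc _ with P k
...   | zero = inj₁ refl
...   | suc _ = inj₂ refl

allBelow-sound : ∀ k P → allBelow k P ≢ 0 → ∀ i → i < k → P i ≢ 0
allBelow-sound (suc k) P h i i<1+k with allBelow k P in eqAll | P k in eqP
... | zero | _ = ⊥-elim (h refl)
... | suc _ | zero = ⊥-elim (h refl)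
... | suc _ | suc _ with m≤n⇒m<n∨m≡n (s≤s⁻¹ i<1+k)
...   | inj₁ i<k = allBelow-sound k P (λ e → 0≢1+n (trans (sym e) eqAll)) i i<k
...   | inj₂ refl = λ e → 0≢1+n (trans (sym e) eqP)

allBelow-complete : ∀ k P → (∀ i → i < k → P i ≢ 0) → allBelow k P ≡ 1
allBelow-complete zero P h = refl
allBelow-complete (suc k) P h
  rewrite allBelow-complete k P (λ i i<k → h i (m≤n⇒m≤1+n i<k)) with P k | h k ≤-refl
... | zero | Pk≢0 = ⊥-elim (Pk≢0 refl)
... | suc _ | _ = refl

codeBDrop : ℕ → ℕ → ℕ
codeBDrop m i = primRec m (λ _ r → half (r ∸ᵖ 1)) i

bitAt : ℕ → ℕ → ℕ
bitAt m i = parity (codeBDrop m i ∸ᵖ 1)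

codeBDropᵀ : ∀ {n} → Term n → Term n → Term n
codeBDropᵀ a i = `rec a (halfᵀ (#1 ∸ᵀ `1)) i

bitAtᵀ : ∀ {n} → Term n → Term n → Term n
bitAtᵀ a i = parityᵀ (codeBDropᵀ a i ∸ᵀ `1)

headBit : List Bool → ℕ
headBit [] = 0
headBit (b ∷ _) = bit b

drop-suc : ∀ {A : Set} i (xs : List A) → drop (suc i) xs ≡ drop 1 (drop i xs)
drop-suc i xs = trans (cong (λ k → drop k xs) (+-comm 1 i)) (sym (drop-drop i 1 xs))

codeB-drop1 : ∀ τ → codeB (drop 1 τ) ≡ half (codeB τ ∸ᵖ 1)
codeB-drop1 [] = refl
codeB-drop1 (b ∷ τ) = sym (half-bit b (codeB τ))

codeBDrop-codeB : ∀ σ i → codeBDrop (codeB σ) i ≡ codeB (drop i σ)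
codeBDrop-codeB σ zero = refl
codeBDrop-codeB σ (suc i) = begin
  half (codeBDrop (codeB σ) i ∸ᵖ 1)  ≡⟨ cong (λ c → half (c ∸ᵖ 1)) (codeBDrop-codeB σ i) ⟩
  half (codeB (drop i σ) ∸ᵖ 1)        ≡⟨ sym (codeB-drop1 (drop i σ)) ⟩
  codeB (drop 1 (drop i σ))           ≡⟨ cong codeB (sym (drop-suc i σ)) ⟩
  codeB (drop (suc i) σ)              ∎
  where open ≡-Reasoning

parity-codeB : ∀ τ → parity (codeB τ ∸ᵖ 1) ≡ headBit τ
parity-codeB [] = refl
parity-codeB (b ∷ τ) = parity-bit b (codeB τ)

bitAt-codeB : ∀ σ i → bitAt (codeB σ) i ≡ headBit (drop i σ)
bitAt-codeB σ i = trans (cong (λ c → parity (c ∸ᵖ 1)) (codeBDrop-codeB σ i)) (parity-codeB (drop i σ))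

codeB≡0 : ∀ {τ} → codeB τ ≡ 0 → τ ≡ []
codeB≡0 {[]} _ = refl

n≤bit+2*n : ∀ b n → n ≤ bit b + 2 * n
n≤bit+2*n b n = ≤-trans (m≤m+n n (n + 0)) (m≤n+m (2 * n) (bit b))

length≤codeB : ∀ σ → length σ ≤ codeB σ
length≤codeB [] = z≤n
length≤codeB (b ∷ σ) = s≤s (≤-trans (length≤codeB σ) (n≤bit+2*n b (codeB σ)))

toBit : ℕ → Bool
toBit zero = false
toBit (suc _) = true

-- the first argument is fuel, enough as soon as it bounds the code
decodeWith : ℕ → ℕ → List Bool
decodeWith zero n = []
decodeWith (suc f) zero = []
decodeWith (suc f) (suc n) = toBit (parity n) ∷ decodeWith f (half n)

decodeB : ℕ → List Bool
decodeB n = decodeWith n n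

bit-toBit : ∀ {n} → n ≡ 0 ⊎ n ≡ 1 → bit (toBit n) ≡ n
bit-toBit (inj₁ refl) = refl
bit-toBit (inj₂ refl) = refl

toBit-bit : ∀ b → toBit (bit b) ≡ b
toBit-bit false = refl
toBit-bit true = refl

half≤ : ∀ n → half n ≤ n
half≤ n = ≤-trans (n≤bit+2*n false (half n)) (≤-trans (m≤n+m (2 * half n) (parity n)) (≤-reflexive (parity+2*half n)))

codeB-decodeWith : ∀ f n → n ≤ f → codeB (decodeWith f n) ≡ n
codeB-decodeWith zero zero _ = refl
codeB-decodeWith (suc f) zero _ = refl
codeB-decodeWith (suc f) (suc n) (s≤s n≤f) = cong suc (begin
  bit (toBit (parity n)) + 2 * codeB (decodeWith f (half n))
    ≡⟨ cong₂ (λ p h → p + 2 * h) (bit-toBit (parity∈01 n)) (codeB-decodeWith f (half n) (≤-trans (half≤ n) n≤f)) ⟩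
  parity n + 2 * half n
    ≡⟨ parity+2*half n ⟩
  n ∎)
  where open ≡-Reasoning

codeB-decodeB : ∀ n → codeB (decodeB n) ≡ n
codeB-decodeB n = codeB-decodeWith n n ≤-refl

decodeWith-codeB : ∀ f σ → codeB σ ≤ f → decodeWith f (codeB σ) ≡ σ
decodeWith-codeB zero [] _ = refl
decodeWith-codeB (suc f) [] _ = refl
decodeWith-codeB (suc f) (b ∷ σ) (s≤s c≤f) = cong₂ _∷_
  (trans (cong toBit (parity-bit b (codeB σ))) (toBit-bit b))
  (trans (cong (decodeWith f) (half-bit b (codeB σ)))
         (decodeWith-codeB f σ (≤-trans (n≤bit+2*n b (codeB σ)) c≤f)))

decodeB-codeB : ∀ σ → decodeB (codeB σ) ≡ σ
decodeB-codeB σ = decodeWith-codeB (codeB σ) σ ≤-refl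

⪯-refl : ∀ τ → τ ⪯ τ
⪯-refl τ = [] , ++-identityʳ τ

⪯-antisym : ∀ {σ τ} → σ ⪯ τ → τ ⪯ σ → σ ≡ τ
⪯-antisym {σ} (υ , refl) (υ′ , e) = trans (sym (++-identityʳ σ)) (cong (σ ++_) (sym υ≡[]))
  where
  υ≡[] : υ ≡ []
  υ≡[] = ++-conicalˡ υ υ′ (++-identityʳ-unique σ (sym (trans (sym (++-assoc σ υ υ′)) e)))

⪯-cancelˡ : ∀ ρ σ τ → (ρ ++ σ) ⪯ (ρ ++ τ) → σ ⪯ τ
⪯-cancelˡ ρ σ τ (υ , e) = υ , ++-cancelˡ ρ (σ ++ υ) τ (trans (sym (++-assoc ρ σ υ)) e)

⪯-extendˡ : ∀ ρ σ τ → σ ⪯ τ → (ρ ++ σ) ⪯ (ρ ++ τ)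
⪯-extendˡ ρ σ τ (υ , e) = υ , trans (++-assoc ρ σ υ) (cong (ρ ++_) e)

HeadAgrees : List Bool → List Bool → Set
HeadAgrees [] _ = ⊤
HeadAgrees (b ∷ _) [] = ⊥
HeadAgrees (b ∷ _) (b′ ∷ _) = b ≡ b′

⪯⇒HeadAgrees : ∀ σ τ → σ ⪯ τ → ∀ i → HeadAgrees (drop i σ) (drop i τ)
⪯⇒HeadAgrees [] τ _ zero = tt
⪯⇒HeadAgrees [] τ _ (suc i) = tt
⪯⇒HeadAgrees (b ∷ σ) .(b ∷ σ ++ υ) (υ , refl) zero = refl
⪯⇒HeadAgrees (b ∷ σ) .(b ∷ σ ++ υ) (υ , refl) (suc i) = ⪯⇒HeadAgrees σ (σ ++ υ) (υ , refl) i

HeadAgrees⇒⪯ : ∀ σ τ → (∀ i → HeadAgrees (drop i σ) (drop i τ)) → σ ⪯ τ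
HeadAgrees⇒⪯ [] τ _ = τ , refl
HeadAgrees⇒⪯ (b ∷ σ) [] h = ⊥-elim (h 0)
HeadAgrees⇒⪯ (b ∷ σ) (b′ ∷ τ) h with h 0 | HeadAgrees⇒⪯ σ τ (h ∘ suc)
... | refl | υ , e = υ , cong (b ∷_) e

headTest : List Bool → List Bool → ℕ
headTest σ τ = ifZero (codeB σ) 1 (ifZero (codeB τ) 0 (headBit σ ≟ᵖ headBit τ))

headTest-sound : ∀ σ τ → headTest σ τ ≢ 0 → HeadAgrees σ τ
headTest-sound [] τ h = tt
headTest-sound (b ∷ σ) [] h = h refl
headTest-sound (b ∷ σ) (b′ ∷ τ) h = bit-injective (≟ᵖ-sound (bit b) (bit b′) h)
  where
  bit-injective : ∀ {b b′} → bit b ≡ bit b′ → b ≡ b′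
  bit-injective {false} {false} _ = refl
  bit-injective {true} {true} _ = refl

headTest-complete : ∀ σ τ → HeadAgrees σ τ → headTest σ τ ≢ 0
headTest-complete [] τ _ = λ ()
headTest-complete (b ∷ σ) (b′ ∷ τ) refl = ≟ᵖ-complete {bit b} refl

prefixTestAt : ℕ → ℕ → ℕ → ℕ
prefixTestAt a b i = ifZero (codeBDrop a i) 1 (ifZero (codeBDrop b i) 0 (bitAt a i ≟ᵖ bitAt b i))

isPrefix : ℕ → ℕ → ℕ
isPrefix a b = allBelow (suc a) (prefixTestAt a b)

isPrefixT : Term 2
isPrefixT = allᵀ (`suc #0)
  (ifZeroᵀ (codeBDropᵀ #2 #0) `1 (ifZeroᵀ (codeBDropᵀ #3 #0) `0 (bitAtᵀ #2 #0 ≟ᵀ bitAtᵀ #3 #0)))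

isPrefixᵀ : ∀ {n} → Term n → Term n → Term n
isPrefixᵀ a b = `app isPrefixT (a ∷ b ∷ [])

prefixTestAt-codeB : ∀ σ τ i → prefixTestAt (codeB σ) (codeB τ) i ≡ headTest (drop i σ) (drop i τ)
prefixTestAt-codeB σ τ i = cong₂ (λ u v → ifZero u 1 v) (codeBDrop-codeB σ i)
  (cong₂ (λ u v → ifZero u 0 v) (codeBDrop-codeB τ i) (cong₂ _≟ᵖ_ (bitAt-codeB σ i) (bitAt-codeB τ i)))

isPrefix-sound : ∀ σ τ → isPrefix (codeB σ) (codeB τ) ≢ 0 → σ ⪯ τ
isPrefix-sound σ τ h = HeadAgrees⇒⪯ σ τ agrees
  where
  agrees : ∀ i → HeadAgrees (drop i σ) (drop i τ)
  agrees i with i ≤? codeB σ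
  ... | yes i≤c = headTest-sound (drop i σ) (drop i τ)
        (subst (_≢ 0) (prefixTestAt-codeB σ τ i)
               (allBelow-sound (suc (codeB σ)) (prefixTestAt (codeB σ) (codeB τ)) h i (s≤s i≤c)))
  ... | no i≰c rewrite drop-all i σ (≤-trans (length≤codeB σ) (<⇒≤ (≰⇒> i≰c))) = tt

isPrefix-complete : ∀ σ τ → σ ⪯ τ → isPrefix (codeB σ) (codeB τ) ≡ 1
isPrefix-complete σ τ σ⪯τ = allBelow-complete (suc (codeB σ)) (prefixTestAt (codeB σ) (codeB τ)) λ i _ →
  subst (_≢ 0) (sym (prefixTestAt-codeB σ τ i)) (headTest-complete _ _ (⪯⇒HeadAgrees σ τ σ⪯τ i))

isPrefix∈01 : ∀ a b → isPrefix a b ≡ 0 ⊎ isPrefix a b ≡ 1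
isPrefix∈01 a b = allBelow∈01 (suc a) (prefixTestAt a b)

isPrefix⇒⪯ : ∀ a b → isPrefix a b ≢ 0 → decodeB a ⪯ decodeB b
isPrefix⇒⪯ a b h = isPrefix-sound (decodeB a) (decodeB b)
  (subst₂ (λ u v → isPrefix u v ≢ 0) (sym (codeB-decodeB a)) (sym (codeB-decodeB b)) h)

⪯⇒isPrefix : ∀ a b → decodeB a ⪯ decodeB b → isPrefix a b ≡ 1
⪯⇒isPrefix a b h = subst₂ (λ u v → isPrefix u v ≡ 1) (codeB-decodeB a) (codeB-decodeB b) (isPrefix-complete _ _ h)

isPrefix-cong : ∀ a b c d → (decodeB a ⪯ decodeB b → decodeB c ⪯ decodeB d) →
                (decodeB c ⪯ decodeB d → decodeB a ⪯ decodeB b) → isPrefix a b ≡ isPrefix c d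
isPrefix-cong a b c d to from = go (isPrefix∈01 a b) (isPrefix∈01 c d)
  where
  go : isPrefix a b ≡ 0 ⊎ isPrefix a b ≡ 1 → isPrefix c d ≡ 0 ⊎ isPrefix c d ≡ 1 → isPrefix a b ≡ isPrefix c d
  go (inj₁ ab≡0) (inj₁ cd≡0) = trans ab≡0 (sym cd≡0)
  go (inj₂ ab≡1) (inj₂ cd≡1) = trans ab≡1 (sym cd≡1)
  go (inj₁ ab≡0) (inj₂ cd≡1) =
    ⊥-elim (≡1⇒≢0 (⪯⇒isPrefix a b (from (isPrefix⇒⪯ c d (≡1⇒≢0 cd≡1)))) ab≡0)
  go (inj₂ ab≡1) (inj₁ cd≡0) =
    ⊥-elim (≡1⇒≢0 (⪯⇒isPrefix c d (to (isPrefix⇒⪯ a b (≡1⇒≢0 ab≡1)))) cd≡0)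

Image : (List Bool → List Bool) → List Bool → Set
Image g ρ = Σ (List Bool) λ τ → g τ ≡ ρ

OrderEmbedding : (List Bool → List Bool) → Set
OrderEmbedding g = ∀ τ τ′ → (τ ⪯ τ′ → g τ ⪯ g τ′) × (g τ ⪯ g τ′ → τ ⪯ τ′)

image-isoFullTree : ∀ g → OrderEmbedding g → IsoFullTree (Image g)
image-isoFullTree g emb = g , (λ τ → τ , refl) , (λ _ h → h) , injective , emb
  where
  reflects : ∀ {τ τ′} → g τ ≡ g τ′ → τ ⪯ τ′
  reflects {τ} {τ′} e = proj₂ (emb τ τ′) (subst (g τ ⪯_) e (⪯-refl (g τ)))
  injective : ∀ τ τ′ → g τ ≡ g τ′ → τ ≡ τ′
  injective τ τ′ e = ⪯-antisym (reflects e) (reflects (sym e))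

extTo-image : ∀ x g c σ → OrderEmbedding g → (∀ τ → colour x (g τ) ≡ c) →
              codeB σ ≡ x 0 → Image g σ → ExtTo x
extTo-image x g c σ emb mono σ≡x0 σ∈g =
  σ , σ≡x0 , Image g , image-isoFullTree g emb , (c , λ { _ (τ , refl) → mono τ }) , σ∈g

entry : List ℕ → ℕ → ℕ
entry s k with drop k s
... | [] = 0
... | a ∷ _ = a

codeDrop : ℕ → ℕ → ℕ
codeDrop m i = primRec m (λ _ r → unpair₂ (r ∸ᵖ 1)) i

entryAt : ℕ → ℕ → ℕ
entryAt m i = unpair₁ (codeDrop m i ∸ᵖ 1)

codeDropᵀ : ∀ {n} → Term n → Term n → Term n
codeDropᵀ a i = `rec a (unpair₂ᵀ (#1 ∸ᵀ `1)) i

entryAtᵀ : ∀ {n} → Term n → Term n → Term n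
entryAtᵀ a i = unpair₁ᵀ (codeDropᵀ a i ∸ᵀ `1)

codeDrop-code : ∀ s i → codeDrop (code s) i ≡ code (drop i s)
codeDrop-code s zero = refl
codeDrop-code s (suc i) rewrite codeDrop-code s i | drop-suc i s with drop i s
... | [] = refl
... | a ∷ t = unpair₂-pair a (code t)

entryAt-code : ∀ s i → entryAt (code s) i ≡ entry s i
entryAt-code s i rewrite codeDrop-code s i with drop i s
... | [] = refl
... | a ∷ t = unpair₁-pair a (code t)

length≤code : ∀ s → length s ≤ code s
length≤code [] = z≤n
length≤code (a ∷ s) = s≤s (≤-trans (length≤code s) (m≤n+m (code s) (tri (a + code s))))

code-drop-≢0 : ∀ i (s : List ℕ) → i < length s → code (drop i s) ≢ 0
code-drop-≢0 zero (a ∷ s) _ = λ ()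
code-drop-≢0 (suc i) (a ∷ s) (s≤s i<l) = code-drop-≢0 i s i<l

entry-++ : ∀ i (s t : List ℕ) → i < length s → entry (s ++ t) i ≡ entry s i
entry-++ zero (a ∷ s) t _ = refl
entry-++ (suc i) (a ∷ s) t (s≤s i<l) = entry-++ i s t i<l

length-initSeg : ∀ p m → length (initSeg p m) ≡ m
length-initSeg p zero = refl
length-initSeg p (suc m) = cong suc (length-initSeg (p ∘ suc) m)

entry-initSeg : ∀ p m k → k < m → entry (initSeg p m) k ≡ p k
entry-initSeg p (suc m) zero _ = refl
entry-initSeg p (suc m) (suc k) (s≤s k<m) = entry-initSeg (p ∘ suc) m k k<m

record Coherent (x : Seq) (e : ℕ → ℕ) (i j : ℕ) : Set where
  field
    root       : i ≡ 0 → e 0 ≡ x 0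
    sameColour : x (suc (e i)) ≡ x (suc (e 0))
    order      : isPrefix i j ≡ isPrefix (e i) (e j)

Coherent-cong : ∀ {x e e′ i j} → e 0 ≡ e′ 0 → e i ≡ e′ i → e j ≡ e′ j →
                Coherent x e i j → Coherent x e′ i j
Coherent-cong {x} e0 ei ej c = record
  { root = λ i≡0 → trans (sym e0) (root i≡0)
  ; sameColour = subst₂ (λ u v → x (suc u) ≡ x (suc v)) ei e0 sameColour
  ; order = trans order (cong₂ isPrefix ei ej) }
  where open Coherent c

rootTest : Seq → ℕ → ℕ → ℕ
rootTest x i e₀ = ifZero i (e₀ ≟ᵖ x 0) 1

coherenceTest : Seq → ℕ → ℕ → (e₀ eᵢ eⱼ : ℕ) → ℕ
coherenceTest x i j e₀ eᵢ eⱼ =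
  (rootTest x i e₀ ∧ᵖ (x (suc eᵢ) ≟ᵖ x (suc e₀))) ∧ᵖ (isPrefix i j ≟ᵖ isPrefix eᵢ eⱼ)

coherenceT : Term 5
coherenceT =
  (ifZeroᵀ #0 (#2 ≟ᵀ `orc `0) `1 ∧ᵀ (`orc (`suc #3) ≟ᵀ `orc (`suc #2))) ∧ᵀ (isPrefixᵀ #0 #1 ≟ᵀ isPrefixᵀ #3 #4)

module _ (x : Seq) (e : ℕ → ℕ) (i j : ℕ) where
  private
    rootColour = rootTest x i (e 0) ∧ᵖ (x (suc (e i)) ≟ᵖ x (suc (e 0)))
    orderTest = isPrefix i j ≟ᵖ isPrefix (e i) (e j)

  coherenceTest-sound : coherenceTest x i j (e 0) (e i) (e j) ≢ 0 → Coherent x e i j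
  coherenceTest-sound h = record
    { root = root i (proj₁ rc)
    ; sameColour = ≟ᵖ-sound _ _ (proj₂ rc)
    ; order = ≟ᵖ-sound _ _ (proj₂ both) }
    where
    both = ∧ᵖ-sound rootColour orderTest h
    rc = ∧ᵖ-sound (rootTest x i (e 0)) (x (suc (e i)) ≟ᵖ x (suc (e 0))) (proj₁ both)
    root : ∀ i → rootTest x i (e 0) ≢ 0 → i ≡ 0 → e 0 ≡ x 0
    root .0 h refl = ≟ᵖ-sound _ _ h

  coherenceTest-complete : Coherent x e i j → coherenceTest x i j (e 0) (e i) (e j) ≢ 0
  coherenceTest-complete c = ∧ᵖ-complete rootColour orderTest
    (∧ᵖ-complete (rootTest x i (e 0)) _ (root-ok i root) (≟ᵖ-complete sameColour)) (≟ᵖ-complete order)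
    where
    open Coherent c
    root-ok : ∀ i → (i ≡ 0 → e 0 ≡ x 0) → rootTest x i (e 0) ≢ 0
    root-ok zero r = ≟ᵖ-complete (r refl)
    root-ok (suc i) _ = λ ()

pairTest : Seq → ℕ → ℕ → ℕ → ℕ
pairTest x n i j = ifZero (codeDrop n i) 1 (ifZero (codeDrop n j) 1
  (coherenceTest x i j (entryAt n 0) (entryAt n i) (entryAt n j)))

pairTestT : Term 3
pairTestT = ifZeroᵀ (codeDropᵀ #0 #1) `1 (ifZeroᵀ (codeDropᵀ #0 #2) `1
  (`app coherenceT (#1 ∷ #2 ∷ entryAtᵀ #0 `0 ∷ entryAtᵀ #0 #1 ∷ entryAtᵀ #0 #2 ∷ [])))

extensionTree : Seq → Seq
extensionTree x n = allBelow (suc n) (λ i → allBelow (suc n) (λ j → pairTest x n i j))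

extensionTreeT : Term 1
extensionTreeT = allᵀ (`suc #0) (allᵀ (`suc #2) (`app pairTestT (#4 ∷ #2 ∷ #0 ∷ [])))

extensionTreeT-correct : ∀ x n → ⟦ extensionTreeT ⟧ x (n ∷ []) ≡ extensionTree x n
extensionTreeT-correct x n = refl

module _ (x : Seq) (s : List ℕ) where
  private
    n = code s
    coherenceAt : ℕ → ℕ → ℕ
    coherenceAt i j = coherenceTest x i j (entryAt n 0) (entryAt n i) (entryAt n j)

  codeDrop-≢0 : ∀ {i} → i < length s → codeDrop n i ≢ 0
  codeDrop-≢0 {i} i<l = subst (_≢ 0) (sym (codeDrop-code s i)) (code-drop-≢0 i s i<l)

  codeDrop-≡0 : ∀ {i} → length s ≤ i → codeDrop n i ≡ 0
  codeDrop-≡0 {i} l≤i = trans (codeDrop-code s i) (cong code (drop-all i s l≤i))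

  pairTest-inside : ∀ {i j} → i < length s → j < length s →
                    pairTest x n i j ≡ coherenceTest x i j (entry s 0) (entry s i) (entry s j)
  pairTest-inside {i} {j} i<l j<l = begin
    pairTest x n i j
      ≡⟨ ifZero-≢0 (codeDrop n i) 1 _ (codeDrop-≢0 i<l) ⟩
    ifZero (codeDrop n j) 1 (coherenceAt i j)
      ≡⟨ ifZero-≢0 (codeDrop n j) 1 _ (codeDrop-≢0 j<l) ⟩
    coherenceAt i j
      ≡⟨ cong₃ (coherenceTest x i j) (entryAt-code s 0) (entryAt-code s i) (entryAt-code s j) ⟩
    coherenceTest x i j (entry s 0) (entry s i) (entry s j) ∎
    where open ≡-Reasoning

  pairTest-≢0 : ∀ {i j} → (i < length s → j < length s → Coherent x (entry s) i j) → pairTest x n i j ≢ 0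
  pairTest-≢0 {i} {j} coh with i <? length s | j <? length s
  ... | yes i<l | yes j<l = subst (_≢ 0) (sym (pairTest-inside i<l j<l))
                              (coherenceTest-complete x (entry s) i j (coh i<l j<l))
  ... | no i≮l | _ rewrite codeDrop-≡0 (≮⇒≥ i≮l) = λ ()
  ... | yes i<l | no j≮l = ≡1⇒≢0 (begin
    pairTest x n i j
      ≡⟨ ifZero-≢0 (codeDrop n i) 1 _ (codeDrop-≢0 i<l) ⟩
    ifZero (codeDrop n j) 1 (coherenceAt i j)
      ≡⟨ cong (λ c → ifZero c 1 (coherenceAt i j)) (codeDrop-≡0 (≮⇒≥ j≮l)) ⟩
    1 ∎)
    where open ≡-Reasoning

  extensionTree-sound : extensionTree x n ≢ 0 →
                        ∀ {i j} → i < length s → j < length s → Coherent x (entry s) i j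
  extensionTree-sound h {i} {j} i<l j<l = coherenceTest-sound x (entry s) i j
    (subst (_≢ 0) (pairTest-inside i<l j<l) (allBelow-sound (suc n) (pairTest x n i) row j (below j<l)))
    where
    below : ∀ {k} → k < length s → k < suc n
    below k<l = ≤-trans k<l (m≤n⇒m≤1+n (length≤code s))
    row : allBelow (suc n) (pairTest x n i) ≢ 0
    row = allBelow-sound (suc n) (λ i → allBelow (suc n) (pairTest x n i)) h i (below i<l)

  extensionTree-complete : (∀ {i j} → i < length s → j < length s → Coherent x (entry s) i j) →
                           extensionTree x n ≡ 1
  extensionTree-complete coh = allBelow-complete (suc n) _ λ i _ →
    ≡1⇒≢0 (allBelow-complete (suc n) (pairTest x n i) λ j _ → pairTest-≢0 {i} {j} coh)

module _ (x : Seq) where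

  extensionTree-isTree : IsTree (extensionTree x)
  extensionTree-isTree = (λ n → allBelow∈01 (suc n) (λ i → allBelow (suc n) (pairTest x n i))) , closed
    where
    closed : ∀ s t → (s ++ t) ∈T extensionTree x → s ∈T extensionTree x
    closed s t st∈T = extensionTree-complete x s λ i<l j<l →
      Coherent-cong (entry-++ 0 s t (≤-trans (s≤s z≤n) i<l)) (entry-++ _ s t i<l) (entry-++ _ s t j<l)
        (extensionTree-sound x (s ++ t) (≡1⇒≢0 st∈T) (extend i<l) (extend j<l))
      where
      extend : ∀ {i} → i < length s → i < length (s ++ t)
      extend i<l = ≤-trans i<l (≤-trans (m≤m+n (length s) (length t)) (≤-reflexive (sym (length-++ s))))

  path⇒coherent : ∀ p → (∀ n → initSeg p n ∈T extensionTree x) → ∀ i j → Coherent x p i j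
  path⇒coherent p onPath i j =
    Coherent-cong (entry-initSeg p m 0 (s≤s z≤n)) (entry-initSeg p m i i<m) (entry-initSeg p m j j<m)
      (extensionTree-sound x (initSeg p m) (≡1⇒≢0 (onPath m)) (inSeg i<m) (inSeg j<m))
    where
    m = suc (i + j)
    i<m : i < m
    i<m = s≤s (m≤m+n i j)
    j<m : j < m
    j<m = s≤s (m≤n+m j i)
    inSeg : ∀ {k} → k < m → k < length (initSeg p m)
    inSeg {k} k<m = subst (k <_) (sym (length-initSeg p m)) k<m

  coherent⇒path : ∀ p → (∀ i j → Coherent x p i j) → ∀ n → initSeg p n ∈T extensionTree x
  coherent⇒path p coh n = extensionTree-complete x (initSeg p n) λ {i} {j} i<l j<l →
    Coherent-cong (sym (entry-initSeg p n 0 (≤-trans (s≤s z≤n) (inRange i<l))))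
                  (sym (entry-initSeg p n i (inRange i<l))) (sym (entry-initSeg p n j (inRange j<l))) (coh i j)
    where
    inRange : ∀ {k} → k < length (initSeg p n) → k < n
    inRange {k} = subst (k <_) (length-initSeg p n)

  extensionTree-path⇒extTo : HasPath (extensionTree x) → ExtTo x
  extensionTree-path⇒extTo (p , onPath) =
    extTo-image x g (x (suc (p 0))) (decodeB (x 0)) embedding sameColour (codeB-decodeB (x 0)) ([] , rootImage)
    where
    coh = path⇒coherent p onPath
    g : List Bool → List Bool
    g τ = decodeB (p (codeB τ))
    embedding : OrderEmbedding g
    embedding τ τ′ =
      (λ τ⪯τ′ → isPrefix⇒⪯ _ _ (subst (_≢ 0) order (≡1⇒≢0 (isPrefix-complete τ τ′ τ⪯τ′)))) ,
      (λ gτ⪯gτ′ → isPrefix-sound τ τ′ (subst (_≢ 0) (sym order) (≡1⇒≢0 (⪯⇒isPrefix _ _ gτ⪯gτ′))))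
      where open Coherent (coh (codeB τ) (codeB τ′))
    sameColour : ∀ τ → colour x (g τ) ≡ x (suc (p 0))
    sameColour τ = trans (cong (x ∘ suc) (codeB-decodeB (p (codeB τ)))) (Coherent.sameColour (coh (codeB τ) 0))
    rootImage : g [] ≡ decodeB (x 0)
    rootImage = cong decodeB (Coherent.root (coh 0 0) refl)

  extTo⇒extensionTree-path : ExtTo x → HasPath (extensionTree x)
  extTo⇒extensionTree-path (σ , σ≡x0 , H , (g , g∈H , onto , _ , embedding) , (c , mono) , σ∈H) =
    p , coherent⇒path p coh
    where
    τ₀ = proj₁ (onto σ σ∈H)
    p : Seq
    p n = codeB (g (τ₀ ++ decodeB n))
    decode-p : ∀ n → decodeB (p n) ≡ g (τ₀ ++ decodeB n)
    decode-p n = decodeB-codeB _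
    coh : ∀ i j → Coherent x p i j
    coh i j = record
      { root = λ _ → trans (cong (codeB ∘ g) (++-identityʳ τ₀)) (trans (cong codeB (proj₂ (onto σ σ∈H))) σ≡x0)
      ; sameColour = trans (mono _ (g∈H _)) (sym (mono _ (g∈H _)))
      ; order = isPrefix-cong i j (p i) (p j)
          (λ i⪯j → subst₂ _⪯_ (sym (decode-p i)) (sym (decode-p j))
                              (proj₁ (embedding _ _) (⪯-extendˡ τ₀ _ _ i⪯j)))
          (λ pi⪯pj → ⪯-cancelˡ τ₀ _ _
                       (proj₂ (embedding _ _) (subst₂ _⪯_ (decode-p i) (decode-p j) pi⪯pj))) }

-- A deterministic automaton reading a binary string from its last letter
-- to its first; it accepts exactly the concatenations of blocks (see below).
data State : Set where
  boundary : ℕ → State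
  afterBit : ℕ → State
  inBlock  : ℕ → ℕ → State
  dead     : State

step : Bool → State → State
step b (boundary c) = afterBit c
step false (afterBit c) = inBlock 0 c
step true (afterBit c) = dead
step true (inBlock k c) = inBlock (suc k) c
step false (inBlock k c) = boundary (suc (pair k c))
step b dead = dead

run : List Bool → State
run [] = boundary 0
run (b ∷ ρ) = step b (run ρ)

stateColour : Seq → State → ℕ
stateColour x (boundary c) = ifZero c 0 (1 ∸ᵖ x c)
stateColour x (afterBit _) = 1
stateColour x (inBlock _ _) = 1
stateColour x dead = 1

stateColour≤1 : ∀ x st → stateColour x st ≤ 1
stateColour≤1 x (boundary zero) = z≤n
stateColour≤1 x (boundary (suc c)) = subst (_≤ 1) (sym (∸ᵖ≡∸ 1 (x (suc c)))) (m∸n≤m 1 (x (suc c)))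
stateColour≤1 x (afterBit _) = ≤-refl
stateColour≤1 x (inBlock _ _) = ≤-refl
stateColour≤1 x dead = ≤-refl

encodeState : State → ℕ
encodeState (boundary c) = pairᵖ 0 (pairᵖ 0 c)
encodeState (afterBit c) = pairᵖ 1 (pairᵖ 0 c)
encodeState (inBlock k c) = pairᵖ 2 (pairᵖ k c)
encodeState dead = pairᵖ 3 0

-- the step from the state coded pairᵖ tag rest, where rest = pairᵖ k c
stepFrom : ℕ → ℕ → ℕ → ℕ → ℕ → ℕ
stepFrom b tag rest k c =
  ifZero tag (pairᵖ 1 rest)
    (ifZero (tag ∸ᵖ 1) (ifZero b (pairᵖ 2 (pairᵖ 0 c)) (pairᵖ 3 0))
      (ifZero (tag ∸ᵖ 2) (ifZero b (pairᵖ 0 (pairᵖ 0 (suc (pairᵖ k c)))) (pairᵖ 2 (pairᵖ (suc k) c)))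
        (pairᵖ 3 0)))

stepFromT : Term 5
stepFromT =
  ifZeroᵀ #1 (pairᵀ `1 #2)
    (ifZeroᵀ (#1 ∸ᵀ `1) (ifZeroᵀ #0 (pairᵀ `2 (pairᵀ `0 #4)) (pairᵀ `3 `0))
      (ifZeroᵀ (#1 ∸ᵀ `2)
        (ifZeroᵀ #0 (pairᵀ `0 (pairᵀ `0 (`suc (pairᵀ #3 #4)))) (pairᵀ `2 (pairᵀ (`suc #3) #4)))
        (pairᵀ `3 `0)))

stepᵖ : ℕ → ℕ → ℕ
stepᵖ b s = stepFrom b (unpair₁ s) (unpair₂ s) (unpair₁ (unpair₂ s)) (unpair₂ (unpair₂ s))

stepT : Term 2
stepT = `app stepFromT
  (#0 ∷ unpair₁ᵀ #1 ∷ unpair₂ᵀ #1 ∷ unpair₁ᵀ (unpair₂ᵀ #1) ∷ unpair₂ᵀ (unpair₂ᵀ #1) ∷ [])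

readStep : ℕ → ℕ → ℕ → ℕ
readStep c b r = ifZero c r (stepᵖ b r)

runᵖ : ℕ → ℕ → ℕ
runᵖ m j = primRec (encodeState (boundary 0))
  (λ j r → readStep (codeBDrop m (m ∸ᵖ suc j)) (bitAt m (m ∸ᵖ suc j)) r) j

runT : Term 2
runT = `rec (pairᵀ `0 (pairᵀ `0 `0))
  (ifZeroᵀ (codeBDropᵀ #2 (#2 ∸ᵀ `suc #0)) #1 (`app stepT (bitAtᵀ #2 (#2 ∸ᵀ `suc #0) ∷ #1 ∷ []))) #1

colourOfCode : Seq → ℕ → ℕ
colourOfCode x s = ifZero (unpair₁ s) (ifZero (unpair₂ (unpair₂ s)) 0 (1 ∸ᵖ x (unpair₂ (unpair₂ s)))) 1

colourOfCodeT : Term 1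
colourOfCodeT =
  ifZeroᵀ (unpair₁ᵀ #0) (ifZeroᵀ (unpair₂ᵀ (unpair₂ᵀ #0)) `0 (`1 ∸ᵀ `orc (unpair₂ᵀ (unpair₂ᵀ #0)))) `1

-- as an instance ⟨f , σ⟩ of TT¹_k-Ext, with σ = [] coded by position 0
treeColouring : Seq → Seq
treeColouring x n = ifZero n 0 (colourOfCode x (runᵖ (n ∸ᵖ 1) (n ∸ᵖ 1)))

treeColouringT : Term 1
treeColouringT = ifZeroᵀ #0 `0 (`app colourOfCodeT (`app runT ((#0 ∸ᵀ `1) ∷ (#0 ∸ᵀ `1) ∷ []) ∷ []))

treeColouringT-correct : ∀ x n → ⟦ treeColouringT ⟧ x (n ∷ []) ≡ treeColouring x n
treeColouringT-correct x n = refl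

unpair₁-pairᵖ : ∀ a b → unpair₁ (pairᵖ a b) ≡ a
unpair₁-pairᵖ a b = trans (cong unpair₁ (pairᵖ≡pair a b)) (unpair₁-pair a b)

unpair₂-pairᵖ : ∀ a b → unpair₂ (pairᵖ a b) ≡ b
unpair₂-pairᵖ a b = trans (cong unpair₂ (pairᵖ≡pair a b)) (unpair₂-pair a b)

stepᵖ-pairᵖ : ∀ b tag k c → stepᵖ b (pairᵖ tag (pairᵖ k c)) ≡ stepFrom b tag (pairᵖ k c) k c
stepᵖ-pairᵖ b tag k c
  rewrite unpair₁-pairᵖ tag (pairᵖ k c) | unpair₂-pairᵖ tag (pairᵖ k c)
        | unpair₁-pairᵖ k c | unpair₂-pairᵖ k c = refl

stepᵖ-encode : ∀ b st → stepᵖ (bit b) (encodeState st) ≡ encodeState (step b st)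
stepᵖ-encode b (boundary c) = stepᵖ-pairᵖ (bit b) 0 0 c
stepᵖ-encode false (afterBit c) = stepᵖ-pairᵖ 0 1 0 c
stepᵖ-encode true (afterBit c) = stepᵖ-pairᵖ 1 1 0 c
stepᵖ-encode false (inBlock k c) =
  trans (stepᵖ-pairᵖ 0 2 k c) (cong (λ n → pairᵖ 0 (pairᵖ 0 (suc n))) (pairᵖ≡pair k c))
stepᵖ-encode true (inBlock k c) = stepᵖ-pairᵖ 1 2 k c
stepᵖ-encode b dead = stepᵖ-pairᵖ (bit b) 3 0 0

readStep-codeB : ∀ τ → readStep (codeB τ) (headBit τ) (encodeState (run (drop 1 τ))) ≡ encodeState (run τ)
readStep-codeB [] = refl
readStep-codeB (b ∷ τ) = stepᵖ-encode b (run τ)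

m∸j≡1+m∸[1+j] : ∀ m j → suc j ≤ m → m ∸ j ≡ suc (m ∸ suc j)
m∸j≡1+m∸[1+j] (suc m) j j<m = +-∸-assoc 1 (s≤s⁻¹ j<m)

runᵖ-codeB : ∀ ρ j → j ≤ codeB ρ → runᵖ (codeB ρ) j ≡ encodeState (run (drop (codeB ρ ∸ j) ρ))
runᵖ-codeB ρ zero _ = cong (encodeState ∘ run) (sym (drop-all (codeB ρ) ρ (length≤codeB ρ)))
runᵖ-codeB ρ (suc j) j<m = begin
  readStep (codeBDrop m (m ∸ᵖ suc j)) (bitAt m (m ∸ᵖ suc j)) (runᵖ m j)
    ≡⟨ cong (λ k → readStep (codeBDrop m k) (bitAt m k) (runᵖ m j)) (∸ᵖ≡∸ m (suc j)) ⟩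
  readStep (codeBDrop m i) (bitAt m i) (runᵖ m j)
    ≡⟨ cong₃ readStep (codeBDrop-codeB ρ i) (bitAt-codeB ρ i) previous ⟩
  readStep (codeB (drop i ρ)) (headBit (drop i ρ)) (encodeState (run (drop 1 (drop i ρ))))
    ≡⟨ readStep-codeB (drop i ρ) ⟩
  encodeState (run (drop i ρ)) ∎
  where
  open ≡-Reasoning
  m = codeB ρ
  i = m ∸ suc j
  previous : runᵖ m j ≡ encodeState (run (drop 1 (drop i ρ)))
  previous = trans (runᵖ-codeB ρ j (<⇒≤ j<m))
    (cong (encodeState ∘ run) (trans (cong (λ k → drop k ρ) (m∸j≡1+m∸[1+j] m j j<m)) (drop-suc i ρ)))

colourOfCode-encode : ∀ x st → colourOfCode x (encodeState st) ≡ stateColour x st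
colourOfCode-encode x (boundary c)
  rewrite unpair₁-pairᵖ 0 (pairᵖ 0 c) | unpair₂-pairᵖ 0 (pairᵖ 0 c) | unpair₂-pairᵖ 0 c = refl
colourOfCode-encode x (afterBit c) rewrite unpair₁-pairᵖ 1 (pairᵖ 0 c) = refl
colourOfCode-encode x (inBlock k c) rewrite unpair₁-pairᵖ 2 (pairᵖ k c) = refl
colourOfCode-encode x dead rewrite unpair₁-pairᵖ 3 0 = refl

colour-treeColouring : ∀ x ρ → colour (treeColouring x) ρ ≡ stateColour x (run ρ)
colour-treeColouring x ρ = begin
  colourOfCode x (runᵖ (codeB ρ) (codeB ρ))          ≡⟨ cong (colourOfCode x) (runᵖ-codeB ρ (codeB ρ) ≤-refl) ⟩
  colourOfCode x (encodeState (run (drop (codeB ρ ∸ codeB ρ) ρ)))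
    ≡⟨ cong (λ k → colourOfCode x (encodeState (run (drop k ρ)))) (n∸n≡0 (codeB ρ)) ⟩
  colourOfCode x (encodeState (run ρ))                ≡⟨ colourOfCode-encode x (run ρ) ⟩
  stateColour x (run ρ)                               ∎
  where open ≡-Reasoning

blocks : List (ℕ × Bool) → List Bool
blocks [] = []
blocks ((a , e) ∷ l) = false ∷ replicate a true ++ false ∷ e ∷ blocks l

entries : List (ℕ × Bool) → List ℕ
entries = map proj₁

run-ones : ∀ a ρ {k c} → run ρ ≡ inBlock k c → run (replicate a true ++ ρ) ≡ inBlock (a + k) c
run-ones zero ρ e = e
run-ones (suc a) ρ e rewrite run-ones a ρ e = refl

run-blocks : ∀ l → run (blocks l) ≡ boundary (code (entries l))
run-blocks [] = refl
run-blocks ((a , e) ∷ l)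
  rewrite run-ones a (false ∷ e ∷ blocks l) (cong (step false ∘ step e) (run-blocks l)) | +-identityʳ a = refl

Parses : List Bool → State → Set
Parses ρ (boundary c) = Σ (List (ℕ × Bool)) λ l → ρ ≡ blocks l × c ≡ code (entries l)
Parses ρ (afterBit c) = Σ Bool λ e → Σ (List (ℕ × Bool)) λ l → ρ ≡ e ∷ blocks l × c ≡ code (entries l)
Parses ρ (inBlock k c) =
  Σ Bool λ e → Σ (List (ℕ × Bool)) λ l → ρ ≡ replicate k true ++ false ∷ e ∷ blocks l × c ≡ code (entries l)
Parses ρ dead = ⊤

step-parses : ∀ b ρ st → Parses ρ st → Parses (b ∷ ρ) (step b st)
step-parses b ρ (boundary c) (l , refl , c≡) = b , l , refl , c≡
step-parses false ρ (afterBit c) (e , l , refl , c≡) = e , l , refl , c≡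
step-parses true ρ (afterBit c) _ = tt
step-parses true ρ (inBlock k c) (e , l , refl , c≡) = e , l , refl , c≡
step-parses false ρ (inBlock k c) (e , l , refl , c≡) = (k , e) ∷ l , refl , cong (suc ∘ pair k) c≡
step-parses b ρ dead _ = tt

run-parses : ∀ ρ → Parses ρ (run ρ)
run-parses [] = [] , refl , refl
run-parses (b ∷ ρ) = step-parses b ρ (run ρ) (run-parses ρ)

colour0⇒blocks : ∀ x → IsTree x → ∀ ρ → stateColour x (run ρ) ≡ 0 →
                 Σ (List (ℕ × Bool)) λ l → ρ ≡ blocks l × (code (entries l) ≡ 0 ⊎ entries l ∈T x)
colour0⇒blocks x (isBinary , _) ρ colour≡0 with run ρ | run-parses ρ
... | boundary c | l , ρ≡ , c≡ = l , ρ≡ , subst (λ c → c ≡ 0 ⊎ x c ≡ 1) c≡ (inTree c colour≡0)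
  where
  inTree : ∀ c → ifZero c 0 (1 ∸ᵖ x c) ≡ 0 → c ≡ 0 ⊎ x c ≡ 1
  inTree zero _ = inj₁ refl
  inTree (suc c) h with isBinary (suc c)
  ... | inj₂ xc≡1 = inj₂ xc≡1
  ... | inj₁ xc≡0 rewrite xc≡0 = ⊥-elim (0≢1+n (sym h))

replicate-cancel : ∀ a a′ ρ ρ′ → replicate a true ++ false ∷ ρ ≡ replicate a′ true ++ false ∷ ρ′ →
                   a ≡ a′ × ρ ≡ ρ′
replicate-cancel zero zero ρ ρ′ refl = refl , refl
replicate-cancel (suc a) (suc a′) ρ ρ′ e with replicate-cancel a a′ ρ ρ′ (∷-injectiveʳ e)
... | refl , ρ≡ρ′ = refl , ρ≡ρ′

blocks-++ : ∀ l l′ → blocks (l ++ l′) ≡ blocks l ++ blocks l′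
blocks-++ [] l′ = refl
blocks-++ ((a , e) ∷ l) l′ = cong (false ∷_) (begin
  replicate a true ++ false ∷ e ∷ blocks (l ++ l′)
    ≡⟨ cong (λ ρ → replicate a true ++ false ∷ e ∷ ρ) (blocks-++ l l′) ⟩
  replicate a true ++ false ∷ e ∷ blocks l ++ blocks l′
    ≡⟨ sym (++-assoc (replicate a true) (false ∷ e ∷ blocks l) (blocks l′)) ⟩
  (replicate a true ++ false ∷ e ∷ blocks l) ++ blocks l′ ∎)
  where open ≡-Reasoning

blocks-prefix : ∀ l υ l′ → blocks l ++ υ ≡ blocks l′ →
                Σ (List (ℕ × Bool)) λ l″ → l′ ≡ l ++ l″ × υ ≡ blocks l″
blocks-prefix [] υ l′ e = l′ , refl , e
blocks-prefix ((a , b) ∷ l) υ ((a′ , b′) ∷ l′) e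
  with replicate-cancel a a′ (b ∷ blocks l ++ υ) (b′ ∷ blocks l′)
         (trans (sym (++-assoc (replicate a true) (false ∷ b ∷ blocks l) υ)) (∷-injectiveʳ e))
... | refl , bl≡bl′ with ∷-injectiveˡ bl≡bl′ | blocks-prefix l υ l′ (∷-injectiveʳ bl≡bl′)
...   | refl | l″ , l′≡ , υ≡ = l″ , cong ((a , b) ∷_) l′≡ , υ≡

label : Seq → List Bool → List (ℕ × Bool)
label p [] = []
label p (b ∷ τ) = (p 0 , b) ∷ label (p ∘ suc) τ

label-++ : ∀ p τ υ → label p (τ ++ υ) ≡ label p τ ++ label (λ n → p (length τ + n)) υ
label-++ p [] υ = refl
label-++ p (b ∷ τ) υ = cong ((p 0 , b) ∷_) (label-++ (p ∘ suc) τ υ)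

bits-label : ∀ p τ → map proj₂ (label p τ) ≡ τ
bits-label p [] = refl
bits-label p (b ∷ τ) = cong (b ∷_) (bits-label (p ∘ suc) τ)

entries-label : ∀ p τ → entries (label p τ) ≡ initSeg p (length τ)
entries-label p [] = refl
entries-label p (b ∷ τ) = cong (p 0 ∷_) (entries-label (p ∘ suc) τ)

blocks-label-embedding : ∀ p → OrderEmbedding (blocks ∘ label p)
blocks-label-embedding p τ τ′ = preserves , reflects
  where
  preserves : τ ⪯ τ′ → blocks (label p τ) ⪯ blocks (label p τ′)
  preserves (υ , refl) = blocks (label _ υ) , sym (trans (cong blocks (label-++ p τ υ)) (blocks-++ (label p τ) _))
  reflects : blocks (label p τ) ⪯ blocks (label p τ′) → τ ⪯ τ′
  reflects (υ , e) with blocks-prefix (label p τ) υ (label p τ′) e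
  ... | l″ , τ′≡ , _ = map proj₂ l″ , (begin
    τ ++ map proj₂ l″                      ≡⟨ cong (_++ map proj₂ l″) (sym (bits-label p τ)) ⟩
    map proj₂ (label p τ) ++ map proj₂ l″  ≡⟨ sym (map-++ proj₂ (label p τ) l″) ⟩
    map proj₂ (label p τ ++ l″)            ≡⟨ cong (map proj₂) (sym τ′≡) ⟩
    map proj₂ (label p τ′)                 ≡⟨ bits-label p τ′ ⟩
    τ′                                     ∎)
    where open ≡-Reasoning

path⇒extTo-treeColouring : ∀ x → HasPath x → ExtTo (treeColouring x)
path⇒extTo-treeColouring x (p , onPath) =
  extTo-image (treeColouring x) (blocks ∘ label p) 0 [] (blocks-label-embedding p) monochromatic refl ([] , refl)
  where
  monochromatic : ∀ τ → colour (treeColouring x) (blocks (label p τ)) ≡ 0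
  monochromatic τ rewrite colour-treeColouring x (blocks (label p τ)) | run-blocks (label p τ)
                        | entries-label p τ = colour0 (code (initSeg p (length τ))) (onPath (length τ))
    where
    colour0 : ∀ c → x c ≡ 1 → ifZero c 0 (1 ∸ᵖ x c) ≡ 0
    colour0 zero _ = refl
    colour0 (suc c) xc≡1 rewrite xc≡1 = refl

StrictChain : (ℕ → List ℕ) → Set
StrictChain s = ∀ n → Σ ℕ λ a → Σ (List ℕ) λ u → s n ++ a ∷ u ≡ s (suc n)

prefix-from-entries : ∀ n q (L : List ℕ) → n ≤ length L → (∀ i → i < n → entry L i ≡ q i) →
                      Σ (List ℕ) λ u → initSeg q n ++ u ≡ L
prefix-from-entries zero q L _ _ = L , refl
prefix-from-entries (suc n) q (a ∷ L) (s≤s n≤l) agree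
  with prefix-from-entries n (q ∘ suc) L n≤l (λ i i<n → agree (suc i) (s≤s i<n))
... | u , e = u , cong₂ _∷_ (sym (agree 0 (s≤s z≤n))) e

module _ (s : ℕ → List ℕ) (strict : StrictChain s) where

  length-chain : ∀ n → n ≤ length (s n)
  length-chain zero = z≤n
  length-chain (suc n) with strict n
  ... | a , u , e = subst (suc n ≤_) (trans (sym (length-++ (s n))) (cong length e))
                      (≤-trans (s≤s (≤-trans (length-chain n) (m≤m+n _ (length u))))
                               (≤-reflexive (sym (+-suc (length (s n)) (length u)))))

  chain-prefix : ∀ m d → Σ (List ℕ) λ u → s m ++ u ≡ s (d + m)
  chain-prefix m zero = [] , ++-identityʳ (s m)
  chain-prefix m (suc d) with chain-prefix m d | strict (d + m)
  ... | u , e | a , v , e′ =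
    u ++ a ∷ v , trans (sym (++-assoc (s m) u (a ∷ v))) (trans (cong (_++ a ∷ v) e) e′)

  limit : Seq
  limit i = entry (s (suc i)) i

  entry-chain : ∀ n i → i < n → entry (s (suc n)) i ≡ limit i
  entry-chain n i i<n with chain-prefix (suc i) (n ∸ i)
  ... | u , e = trans (cong (λ L → entry L i) (trans (cong s (sym later)) (sym e)))
                      (entry-++ i (s (suc i)) u (length-chain (suc i)))
    where
    later : n ∸ i + suc i ≡ suc n
    later = trans (+-suc (n ∸ i) i) (cong suc (m∸n+n≡m (<⇒≤ i<n)))

  limit-prefix : ∀ n → Σ (List ℕ) λ u → initSeg limit n ++ u ≡ s (suc n)
  limit-prefix n =
    prefix-from-entries n limit (s (suc n)) (≤-trans (n≤1+n n) (length-chain (suc n))) (entry-chain n)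

zeros : ℕ → List Bool
zeros zero = []
zeros (suc n) = zeros n ++ false ∷ []

code-++-∷≢0 : ∀ (s : List ℕ) a u → code (s ++ a ∷ u) ≢ 0
code-++-∷≢0 [] a u ()
code-++-∷≢0 (_ ∷ _) a u ()

blocks-strict : ∀ l l′ → blocks l ⪯ blocks l′ → blocks l ≢ blocks l′ →
                Σ ℕ λ a → Σ (List ℕ) λ u → entries l ++ a ∷ u ≡ entries l′
blocks-strict l l′ (υ , e) distinct with blocks-prefix l υ l′ e
... | [] , _ , υ≡[] =
  ⊥-elim (distinct (trans (sym (++-identityʳ (blocks l))) (trans (cong (blocks l ++_) (sym υ≡[])) e)))
... | (a , _) ∷ l″ , l′≡ , _ = a , entries l″ , sym (trans (cong entries l′≡) (map-++ proj₁ l _))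

zeros-distinct : ∀ n → zeros n ≢ zeros (suc n)
zeros-distinct n e with ++-identityʳ-unique (zeros n) e
... | ()

extTo-treeColouring⇒path : ∀ x → IsTree x → ExtTo (treeColouring x) → HasPath x
extTo-treeColouring⇒path x isTree (σ , σ≡ , H , (g , g∈H , _ , injective , embedding) , (c , mono) , σ∈H) =
  limit s strict , λ n → onLimit n (limit-prefix s strict n)
  where
  c≡0 : c ≡ 0
  c≡0 = trans (sym (mono [] (subst H (codeB≡0 σ≡) σ∈H))) (colour-treeColouring x [])
  parse : ∀ τ → Σ (List (ℕ × Bool)) λ l → g τ ≡ blocks l × (code (entries l) ≡ 0 ⊎ entries l ∈T x)
  parse τ = colour0⇒blocks x isTree (g τ)
    (trans (sym (colour-treeColouring x (g τ))) (trans (mono _ (g∈H τ)) c≡0))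
  L : ℕ → List (ℕ × Bool)
  L n = proj₁ (parse (zeros n))
  g≡blocks : ∀ n → g (zeros n) ≡ blocks (L n)
  g≡blocks n = proj₁ (proj₂ (parse (zeros n)))
  s : ℕ → List ℕ
  s n = entries (L n)
  strict : StrictChain s
  strict n = blocks-strict (L n) (L (suc n))
    (subst₂ _⪯_ (g≡blocks n) (g≡blocks (suc n))
            (proj₁ (embedding (zeros n) (zeros (suc n))) (false ∷ [] , refl)))
    (λ e → zeros-distinct n (injective _ _ (trans (g≡blocks n) (trans e (sym (g≡blocks (suc n)))))))
  inTree : ∀ n → s (suc n) ∈T x
  inTree n = [ ⊥-elim ∘ nonEmpty , id ]′ (proj₂ (proj₂ (parse (zeros (suc n)))))
    where
    nonEmpty : code (s (suc n)) ≢ 0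
    nonEmpty = let a , u , e = strict n in subst (λ t → code t ≢ 0) e (code-++-∷≢0 (s n) a u)
  onLimit : ∀ n → Σ (List ℕ) (λ u → initSeg (limit s strict) n ++ u ≡ s (suc n)) →
            initSeg (limit s strict) n ∈T x
  onLimit n (u , e) = proj₂ isTree _ u (subst (_∈T x) (sym e) (inTree n))

flipT : Term 1
flipT = ifZeroᵀ (`orc `1) `1 `0

flipped : Seq → Seq
flipped y _ = ifZero (y 0) 1 0

flipT-computes : ∀ x y → compile flipT ⟨ x ⊕ y ⟩≡ flipped y
flipT-computes x y = computes flipT (x ⊕ y)

flipped-0 : ∀ {y} → IsNum 0 y → IsNum 1 (flipped y)
flipped-0 y≡0 _ = cong (λ v → ifZero v 1 0) (y≡0 0)

flipped-1 : ∀ {y} → IsNum 1 y → IsNum 0 (flipped y)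
flipped-1 y≡1 _ = cong (λ v → ifZero v 1 0) (y≡1 0)

TTExt≤WF : ∀ k → TTExt k ≤W WF
TTExt≤WF k = compile extensionTreeT , compile flipT , λ x _ →
  extensionTree x , computes-as extensionTreeT x _ (extensionTreeT-correct x) , lift (extensionTree-isTree x) ,
  λ { y (lift (inj₁ (path , y≡0))) →
        flipped y , flipT-computes x y , inj₁ (extensionTree-path⇒extTo x path , lift (flipped-0 y≡0))
    ; y (lift (inj₂ (noPath , y≡1))) →
        flipped y , flipT-computes x y , inj₂ (noPath ∘ extTo⇒extensionTree-path x , lift (flipped-1 y≡1)) }

treeColouring<2 : ∀ x τ → colour (treeColouring x) τ < 2
treeColouring<2 x τ = s≤s (subst (_≤ 1) (sym (colour-treeColouring x τ)) (stateColour≤1 x (run τ)))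

WF≤TTExt : ∀ k → 2 ≤ k → WF ≤W TTExt k
WF≤TTExt k 2≤k = compile treeColouringT , compile flipT , λ x isTree →
  treeColouring x , computes-as treeColouringT x _ (treeColouringT-correct x) ,
  lift (λ τ → ≤-trans (treeColouring<2 x τ) 2≤k) ,
  λ { y (inj₁ (ext , lift y≡1)) →
        flipped y , flipT-computes x y , lift (inj₁ (extTo-treeColouring⇒path x (lower isTree) ext , flipped-1 y≡1))
    ; y (inj₂ (noExt , lift y≡0)) →
        flipped y , flipT-computes x y , lift (inj₂ (noExt ∘ path⇒extTo-treeColouring x , flipped-0 y≡0)) }

theorem3p2 : ∀ (k : ℕ) → 2 ≤ k → TTExt k ≡W WF
theorem3p2 k 2≤k = TTExt≤WF k , WF≤TTExt k 2≤k
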